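{- For every integer $k\ge 0$ there is a constant $C_k$ such that for arbitrarily large $n$ there exists an $n$-vertex ordered graph $(G,\prec)$ that is ordered along a Hamiltonian path, is $(2k+1)$-non-crossing, and in which every induced path has at most $C_k(\log n)^{1/(k+1)}$ vertices.
   Context: Graphs are finite and simple. An ordered graph $(G,\prec)$ is a graph $G$ with a total order $\prec$ on $V(G)$. It is ordered along a Hamiltonian path if, writing $V(G)=\{v_1\prec\dots\prec v_n\}$, $v_iv_{i+1}\in E(G)$ for every $1\le i<n$. A crossing is a pair of edges $ab$, $cd$ with $a\prec c\prec b\prec d$. A set of edges is non-crossing if it contains no crossing. $(G,\prec)$ is $m$-non-crossing if $E(G)$ can be partitioned into $m$ (possibly empty) non-crossing sets. -}

module Defs where

open import Data.Nat using (ℕ; suc; _^_; _≤_; ∣_-_∣)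
open import Data.Fin using (Fin; toℕ)
import Data.Fin as Fin
open import Data.Product using (∃; ∃!; _×_)
open import Function.Bundles using (_↔_; _⇔_)
open import Function.Definitions using (Injective; Surjective)
open import Relation.Binary.Core using (Rel; _Preserves_⟶_)
open import Relation.Binary.Definitions using (Decidable; Irreflexive; Symmetric)
open import Relation.Binary.Structures using (IsStrictTotalOrder)
open import Relation.Binary.PropositionalEquality using (_≡_)
open import Relation.Nullary using (¬_)
open import Level using (0ℓ)

record OrderedGraph (n : ℕ) : Set₁ where
  infix 4 _≺_
  field
    V                  : Set
    vertices           : Fin n ↔ V
    Adj                : Rel V 0ℓ
    adj?               : Decidable Adj
    adj-sym            : Symmetric Adj
    adj-irrefl         : Irreflexive _≡_ Adj
    _≺_                : Rel V 0ℓ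
    isStrictTotalOrder : IsStrictTotalOrder _≡_ _≺_

module _ {n : ℕ} (G : OrderedGraph n) where
  open OrderedGraph G

  -- v is the listing v₁ ≺ … ≺ vₙ of all the vertices.
  record IsIncreasingEnumeration (v : Fin n → V) : Set where
    field
      increasing : v Preserves Fin._<_ ⟶ _≺_
      surjective : Surjective _≡_ _≡_ v

  OrderedAlongHamiltonianPath : Set
  OrderedAlongHamiltonianPath =
    ∃ λ (v : Fin n → V) → IsIncreasingEnumeration v ×
      (∀ i j → toℕ j ≡ suc (toℕ i) → Adj (v i) (v j))

  -- A set of (unordered) edges is a symmetric subrelation of adjacency.
  record IsEdgeSet (F : Rel V 0ℓ) : Set where
    field
      symmetric : Symmetric F
      edges     : ∀ {a b} → F a b → Adj a b

  Crossing : (a b c d : V) → Set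
  Crossing a b c d = a ≺ c × c ≺ b × b ≺ d

  -- Since F is symmetric, every way of naming the ends of the two edges
  -- is covered by the quantifiers.
  NonCrossing : Rel V 0ℓ → Set
  NonCrossing F = ∀ {a b c d} → F a b → F c d → ¬ Crossing a b c d

  record IsNonCrossingPartition {m : ℕ} (E : Fin m → Rel V 0ℓ) : Set where
    field
      isEdgeSet   : ∀ i → IsEdgeSet (E i)
      partition   : ∀ {a b} → Adj a b → ∃! _≡_ (λ i → E i a b)
      nonCrossing : ∀ i → NonCrossing (E i)

  _-NonCrossing : ℕ → Set₁
  m -NonCrossing = ∃ λ (E : Fin m → Rel V 0ℓ) → IsNonCrossingPartition E

  record IsInducedPath {p : ℕ} (u : Fin p → V) : Set where
    field
      injective : Injective _≡_ _≡_ u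
      induced   : ∀ i j → Adj (u i) (u j) ⇔ ∣ toℕ i - toℕ j ∣ ≡ 1

-- For n ≥ 1 and the real logarithm in base 2,
-- a ≤ b · log₂ n  if and only if  2 ^ a ≤ n ^ b.
_≤_·log₂_ : ℕ → ℕ → ℕ → Set
a ≤ b ·log₂ n = 2 ^ a ≤ n ^ b

-- p ≤ C · (log₂ n)^(1/r)  over the reals, for n ≥ 1 and r ≥ 1: both sides are
-- nonnegative, so raise them to the power r.  No rounding is involved.
-- For a bound with an unspecified constant C, neither the base of the
-- logarithm nor the restriction to natural C (round up) matters.
_≤_·[log₂_]^1/_ : ℕ → ℕ → ℕ → ℕ → Set
p ≤ C ·[log₂ n ]^1/ r = (p ^ r) ≤ (C ^ r) ·log₂ n

{-# OPTIONS --safe #-}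
module Submission where

-- Let R be a graph on 0, …, B in which 0 and B see every vertex and
-- consecutive vertices are adjacent.  Put a scaled copy of R on every B-adic
-- interval inside [0, B^L].  No new page is needed, because distinct intervals
-- are nested or do not overlap.  An induced path cannot cross an interval
-- between its two ends, which are adjacent; and inside an interval it loses one
-- level with every step away from an end, since that end sees all the vertices
-- of the next scale.  So the longest induced path grows only by 2L, while
-- B grows to B^L.  To iterate, join both extreme vertices to everything: this
-- takes two more pages (the two stars) and creates no long induced path.
-- Starting from a triangle, k + 1 rounds give 2^(L^(k+1)) + 1 vertices,
-- 2k + 1 pages and induced paths with O(L) vertices.

open import Data.Nat using (ℕ; zero; suc; _+_; _*_; _∸_; _^_; _≤_; _<_; z≤n; s≤s; z<s; s<s; NonZero; ∣_-_∣)
open import Data.Nat.DivMod using (_/_; _%_; _mod_; m<n⇒m%n≡m; m%n<n; m≡m%n+[m/n]*n; m<n*o⇒m/o<n; m/n*n≡m)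
open import Data.Nat.Divisibility using (_∣_; _∣?_; divides)
open import Data.Nat.Properties hiding (<-isStrictTotalOrder)
open import Data.Fin using (Fin; zero; suc; toℕ)
import Data.Fin as Fin
open import Data.Fin.Properties using (any?; toℕ<n; toℕ-fromℕ<; toℕ-injective; <-isStrictTotalOrder)
import Data.Fin.Properties as Fin
open import Data.Product using (∃; ∃₂; ∃-syntax; Σ-syntax; _×_; _,_; proj₁; proj₂)
open import Data.Sum using (_⊎_; inj₁; inj₂; swap)
open import Data.Empty using (⊥)
open import Function using (_∘_; id; case_of_)
open import Function.Bundles using (Equivalence)
open import Function.Construct.Identity using (↔-id)
open import Level using (0ℓ)
open import Relation.Binary.Core using (Rel)
open import Relation.Binary.Definitions using (Decidable; Irreflexive; Symmetric; tri<; tri≈; tri>)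
open import Relation.Binary.PropositionalEquality using (_≡_; _≢_; refl; sym; trans; cong; cong₂; subst; subst₂)
open import Relation.Nullary using (¬_; Dec; yes; no; contradiction)
open import Relation.Nullary.Decidable using (map′; ¬?; _×-dec_; _⊎-dec_)
open import Defs

-- Graphs on 0, ..., B, planarity and refinement.

record IsGraphOn (B : ℕ) (R : Rel ℕ 0ℓ) : Set where
  field
    symmetric   : Symmetric R
    irreflexive : Irreflexive _≡_ R
    bounded     : ∀ {x y} → R x y → x ≤ B
    decidable   : Decidable R

  boundedʳ : ∀ {x y} → R x y → y ≤ B
  boundedʳ = bounded ∘ symmetric

Planar : Rel ℕ 0ℓ → Set
Planar R = ∀ {a b c d} → R a b → R c d → a < c → c < b → ¬ (b < d)

Image : (ℕ → ℕ) → Rel ℕ 0ℓ → Rel ℕ 0ℓ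
Image f R a b = ∃₂ λ x y → R x y × a ≡ f x × b ≡ f y

image? : ∀ {B R} f → IsGraphOn B R → Decidable (Image f R)
image? {B} {R} f graph a b =
  map′ (λ (x , _ , y , _ , p) → x , y , p)
       (λ (x , y , p@(r , _)) → x , s≤s (bounded r) , y , s≤s (boundedʳ r) , p)
       (anyUpTo? (λ x → anyUpTo? (λ y → decidable x y ×-dec (a ≟ f x) ×-dec (b ≟ f y)) (suc B)) (suc B))
  where open IsGraphOn graph

image-planar : ∀ {R} f → (∀ {x y} → f x < f y → x < y) → Planar R → Planar (Image f R)
image-planar f f-< planar (_ , _ , r , refl , refl) (_ , _ , s , refl , refl) p q t =
  planar r s (f-< p) (f-< q) (f-< t)

-- Scaled copies of R at the scales B^0, …, B^(i-1), one in every B-adic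
-- interval [g·B^(j+1), (g+1)·B^(j+1)] of [0, B^i].
Refine : ℕ → Rel ℕ 0ℓ → ℕ → Rel ℕ 0ℓ
Refine B R zero    a b = ⊥
Refine B R (suc i) a b =
  Image (_* B ^ i) R a b ⊎ ∃ λ g → g < B × Image (g * B ^ i +_) (Refine B R i) a b

-- The grid of intervals of length S.

Closed : ℕ → ℕ → ℕ → Set
Closed S g x = g * S ≤ x × x ≤ suc g * S

Open : ℕ → ℕ → ℕ → Set
Open S g x = g * S < x × x < suc g * S

closed-shift : ∀ {S r} g → r ≤ S → Closed S g (g * S + r)
closed-shift {S} {r} g r≤S = m≤m+n (g * S) r , subst (g * S + r ≤_) (+-comm (g * S) S) (+-monoʳ-≤ (g * S) r≤S)

¬open-multiple : ∀ {S} g y → ¬ Open S g (y * S)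
¬open-multiple {S} g y (p , q) = <⇒≱ (*-cancelʳ-< S g y p) (m<1+n⇒m≤n (*-cancelʳ-< S y (suc g) q))

-- Two intervals of the grid share at most an endpoint. This forces successive edges of a path to
-- lie in the same copy.
open-closed-unique : ∀ {S} g h {y} → Open S g y → Closed S h y → g ≡ h
open-closed-unique {S} g h (p , q) (p′ , q′) = ≤-antisym
  (m<1+n⇒m≤n (*-cancelʳ-< S g (suc h) (<-≤-trans p q′)))
  (m<1+n⇒m≤n (*-cancelʳ-< S h (suc g) (≤-<-trans p′ q)))

closed⇒open : ∀ {S} g {x} → Closed S g x → ¬ (S ∣ x) → Open S g x
closed⇒open {S} g (p , q) S∤x =
  ≤∧≢⇒< p (λ e → S∤x (divides g (sym e))) , ≤∧≢⇒< q (λ e → S∤x (divides (suc g) e))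

closed-multiple : ∀ {S} .{{_ : NonZero S}} g x → Closed S g (x * S) → x ≡ g ⊎ x ≡ suc g
closed-multiple {S} g x (p , q) with m≤n⇒m<n∨m≡n (*-cancelʳ-≤ x (suc g) S q)
... | inj₂ e       = inj₂ e
... | inj₁ (s≤s l) = inj₁ (≤-antisym l (*-cancelʳ-≤ g x S p))

open⇒∤ : ∀ {S} g {x} → Open S g x → ¬ (S ∣ x)
open⇒∤ g o (divides q refl) = ¬open-multiple g q o

-- Refinement keeps graphs and planarity.

module _ {B : ℕ} .{{_ : NonZero B}} {R : Rel ℕ 0ℓ} (graph : IsGraphOn B R) where
  private module R = IsGraphOn graph

  refine-isGraphOn : ∀ i → IsGraphOn (B ^ i) (Refine B R i)
  refine-isGraphOn zero = record
    { symmetric = λ () ; irreflexive = λ _ () ; bounded = λ () ; decidable = λ _ _ → no λ () }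
  refine-isGraphOn (suc i) = record
    { symmetric   = λ where
        (inj₁ (x , y , r , p , q))             → inj₁ (y , x , R.symmetric r , q , p)
        (inj₂ (g , g<B , x , y , r , p , q)) → inj₂ (g , g<B , y , x , Q.symmetric r , q , p)
    ; irreflexive = λ where
        refl (inj₁ (x , y , r , refl , q))             → R.irreflexive (*-cancelʳ-≡ x y S q) r
        refl (inj₂ (g , g<B , x , y , r , refl , q)) → Q.irreflexive (+-cancelˡ-≡ (g * S) x y q) r
    ; bounded     = λ where
        (inj₁ (x , y , r , refl , q))             → *-monoˡ-≤ S (R.bounded r)
        (inj₂ (g , g<B , x , y , r , refl , q)) →
          ≤-trans (proj₂ (closed-shift g (Q.bounded r))) (*-monoˡ-≤ S g<B)
    ; decidable   = λ a b →
        image? (_* S) graph a b ⊎-dec anyUpTo? (λ g → image? (g * S +_) (refine-isGraphOn i) a b) B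
    }
    where
    S = B ^ i
    instance
      S≢0 : NonZero S
      S≢0 = m^n≢0 B i
    module Q = IsGraphOn (refine-isGraphOn i)

  -- A coarse edge ends at multiples of `S`, and none of these is interior to an interval, where a
  -- crossing with an edge inside it would need one. Edges in different intervals are separated by a
  -- multiple of `S`; two edges in one interval are handled one scale down.
  refine-planar : Planar R → ∀ i → Planar (Refine B R i)
  refine-planar planar zero ()
  refine-planar planar (suc i) = crossing-free
    where
    S = B ^ i
    module Q = IsGraphOn (refine-isGraphOn i)

    crossing-free : Planar (Refine B R (suc i))
    crossing-free (inj₁ r) (inj₁ s) = image-planar (_* S) (λ {x} {y} → *-cancelʳ-< S x y) planar r s
    crossing-free (inj₁ (_ , y , _ , refl , refl)) (inj₂ (g , _ , _ , _ , s , refl , refl)) p q t =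
      ¬open-multiple g y (≤-<-trans (m≤m+n (g * S) _) q , <-≤-trans t (proj₂ (closed-shift g (Q.boundedʳ s))))
    crossing-free (inj₂ (g , _ , _ , _ , s , refl , refl)) (inj₁ (x , _ , _ , refl , refl)) p q t =
      ¬open-multiple g x (≤-<-trans (m≤m+n (g * S) _) p , <-≤-trans q (proj₂ (closed-shift g (Q.boundedʳ s))))
    crossing-free (inj₂ (g , _ , r@(_ , _ , r′ , refl , refl))) (inj₂ (h , _ , s@(_ , _ , s′ , refl , refl))) p q t
      with <-cmp g h
    ... | tri≈ _ refl _ =
      image-planar (g * S +_) (λ {x} {y} → +-cancelˡ-< (g * S) x y) (refine-planar planar i) r s p q t
    ... | tri< g<h _ _ = <⇒≱ q (≤-trans (proj₂ (closed-shift g (Q.boundedʳ r′)))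
                                (≤-trans (*-monoˡ-≤ S g<h) (m≤m+n (h * S) _)))
    ... | tri> _ _ h<g = <⇒≱ (<-trans p (<-trans q t)) (≤-trans (proj₂ (closed-shift h (Q.boundedʳ s′)))
                                (≤-trans (*-monoˡ-≤ S h<g) (m≤m+n (g * S) _)))

-- Induced paths as sequences.

-- ℓ counts the edges; the values of u beyond ℓ are irrelevant.
record IndPath (A : Rel ℕ 0ℓ) (ℓ : ℕ) (u : ℕ → ℕ) : Set where
  field
    distinct  : ∀ {i j} → i < j → j ≤ ℓ → u i ≢ u j
    edge      : ∀ {i} → i < ℓ → A (u i) (u (suc i))
    chordless : ∀ {i j} → suc i < j → j ≤ ℓ → ¬ A (u i) (u j)

module _ {A : Rel ℕ 0ℓ} {u : ℕ → ℕ} where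
  open IndPath

  prefix : ∀ {k ℓ} → k ≤ ℓ → IndPath A ℓ u → IndPath A k u
  prefix k≤ℓ π = record
    { distinct  = λ i<j j≤k → distinct π i<j (≤-trans j≤k k≤ℓ)
    ; edge      = λ i<k → edge π (<-≤-trans i<k k≤ℓ)
    ; chordless = λ i<j j≤k → chordless π i<j (≤-trans j≤k k≤ℓ)
    }

  suffix : ∀ a {ℓ} → IndPath A (a + ℓ) u → IndPath A ℓ (λ t → u (a + t))
  suffix a {ℓ} π = record
    { distinct  = λ i<j j≤ℓ → distinct π (+-monoʳ-< a i<j) (+-monoʳ-≤ a j≤ℓ)
    ; edge      = λ {i} i<ℓ → subst (λ t → A (u (a + i)) (u t)) (sym (+-suc a i)) (edge π (+-monoʳ-< a i<ℓ))
    ; chordless = λ {i} {j} i<j j≤ℓ → chordless π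
        (subst (_< a + j) (+-suc a i) (+-monoʳ-< a i<j)) (+-monoʳ-≤ a j≤ℓ)
    }

  reversal : Symmetric A → ∀ {ℓ} → IndPath A ℓ u → IndPath A ℓ (λ t → u (ℓ ∸ t))
  reversal A-sym {ℓ} π = record
    { distinct  = λ {i} i<j j≤ℓ e → distinct π (∸-monoʳ-< i<j j≤ℓ) (m∸n≤m ℓ i) (sym e)
    ; edge      = λ {i} i<ℓ → A-sym (subst (λ t → A (u (ℓ ∸ suc i)) (u t)) (sym (+-∸-assoc 1 i<ℓ))
                    (edge π (subst (_≤ ℓ) (+-∸-assoc 1 i<ℓ) (m∸n≤m ℓ i))))
    ; chordless = λ {i} {j} i<j j≤ℓ a → chordless π (lemma i<j j≤ℓ) (m∸n≤m ℓ i) (A-sym a)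
    }
    where
    lemma : ∀ {i j} → suc i < j → j ≤ ℓ → suc (ℓ ∸ j) < ℓ ∸ i
    lemma {i} {suc j} (s<s i<j) j<ℓ = subst (_< ℓ ∸ i) (+-∸-assoc 1 j<ℓ) (∸-monoʳ-< i<j (<⇒≤ j<ℓ))

  -- The forward map `to` is asked only for edges of the path, but `from` for all pairs, because it
  -- pulls back possible chords. The uses are scaling (`_* S`), shifting into an interval
  -- (`g * S +_`) and replacing a graph by an equivalent one (`id`).
  transport : ∀ {A′ : Rel ℕ 0ℓ} {ℓ} {v : ℕ → ℕ} (f : ℕ → ℕ) → IndPath A ℓ u →
    (∀ {t} → t ≤ ℓ → u t ≡ f (v t)) →
    (∀ {i} → i < ℓ → A (f (v i)) (f (v (suc i))) → A′ (v i) (v (suc i))) →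
    (∀ {x y} → A′ x y → A (f x) (f y)) →
    IndPath A′ ℓ v
  transport f π e to from = record
    { distinct  = λ i<j j≤ℓ p → distinct π i<j j≤ℓ
        (trans (e (≤-trans (<⇒≤ i<j) j≤ℓ)) (trans (cong f p) (sym (e j≤ℓ))))
    ; edge      = λ i<ℓ → to i<ℓ (subst₂ A (e (<⇒≤ i<ℓ)) (e i<ℓ) (edge π i<ℓ))
    ; chordless = λ i<j j≤ℓ a → chordless π i<j j≤ℓ
        (subst₂ A (sym (e (≤-trans (<⇒≤ (<⇒≤ i<j)) j≤ℓ))) (sym (e j≤ℓ)) (from a))
    }

first : ∀ {P : ℕ → Set} → (∀ t → Dec (P t)) → ∀ ℓ →
  (∀ {t} → t ≤ ℓ → ¬ P t) ⊎ ∃₂ λ m n → m + n ≡ ℓ × P m × (∀ {t} → t < m → ¬ P t)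
first P? ℓ with P? 0
first P? ℓ       | yes p = inj₂ (0 , ℓ , refl , p , λ ())
first P? zero    | no ¬p = inj₁ λ where z≤n → ¬p
first P? (suc ℓ) | no ¬p with first (P? ∘ suc) ℓ
... | inj₁ none                 = inj₁ λ where z≤n → ¬p ; (s≤s t≤ℓ) → none t≤ℓ
... | inj₂ (m , n , e , p , ¬q) =
  inj₂ (suc m , n , cong suc e , p , λ where z<s → ¬p ; (s<s t<m@(s≤s _)) → ¬q t<m)

-- Induced paths in a refinement.

record IsFramed (B : ℕ) (R : Rel ℕ 0ℓ) : Set where
  field
    -- In the copy at scale `S` this joins the two ends of every interval.
    consecutive : ∀ {x} → x < B → R x (suc x)
    left        : ∀ {y} → 0 < y → y ≤ B → R 0 y
    right       : ∀ {x} → x < B → R x B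

module _ {B : ℕ} .{{_ : NonZero B}} {R : Rel ℕ 0ℓ} (graph : IsGraphOn B R) (framed : IsFramed B R) where
  open IndPath
  private
    module R = IsGraphOn graph
    module F = IsFramed framed

  module _ (i : ℕ) where
    private
      S = B ^ i
      A = Refine B R (suc i)
      module A = IsGraphOn (refine-isGraphOn graph (suc i))
      module Q = IsGraphOn (refine-isGraphOn graph i)
      instance
        S≢0 : NonZero S
        S≢0 = m^n≢0 B i

    -- A coarse edge has only multiples of `S` as ends, so this edge belongs to the copy in a single
    -- interval. There `y` is interior, while `x` may be an endpoint.
    refine-fine : ∀ {x y} → A x y → ¬ (S ∣ y) →
      ∃ λ g → g < B × Closed S g x × Open S g y × Refine B R i (x ∸ g * S) (y ∸ g * S)
    refine-fine (inj₁ (_ , y , _ , _ , refl)) S∤y = contradiction (divides y refl) S∤y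
    refine-fine (inj₂ (g , g<B , x , y , r , refl , refl)) S∤y =
      g , g<B , closed-shift g (Q.bounded r) , closed⇒open g (closed-shift g (Q.boundedʳ r)) S∤y ,
      subst₂ (Refine B R i) (sym (m+n∸m≡n (g * S) x)) (sym (m+n∸m≡n (g * S) y)) r

    -- The finer copies create nothing new between multiples: such an edge joins the two ends of one
    -- interval, and `consecutive` already provides it. So the refinement induces exactly a scaled
    -- `R` on the multiples of `S`.
    refine-coarse : ∀ {x y} → A (x * S) (y * S) → R x y
    refine-coarse {x} {y} (inj₁ (x′ , y′ , r , p , q)) =
      subst₂ R (sym (*-cancelʳ-≡ x x′ S p)) (sym (*-cancelʳ-≡ y y′ S q)) r
    refine-coarse {x} {y} a@(inj₂ (g , g<B , r , s , q , e , e′))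
      with closed-multiple g x (subst (Closed S g) (sym e) (closed-shift g (Q.bounded q)))
         | closed-multiple g y (subst (Closed S g) (sym e′) (closed-shift g (Q.boundedʳ q)))
    ... | inj₁ refl | inj₁ refl = contradiction a (A.irreflexive refl)
    ... | inj₁ refl | inj₂ refl = F.consecutive g<B
    ... | inj₂ refl | inj₁ refl = R.symmetric (F.consecutive g<B)
    ... | inj₂ refl | inj₂ refl = contradiction a (A.irreflexive refl)

    module _ {u : ℕ → ℕ} where

      -- Each vertex after `u 0` is interior to the interval of the edge that reaches it, so the
      -- next edge cannot change interval. Only `u 0` may be an endpoint.
      enter : ∀ {ℓ} → IndPath A (suc ℓ) u → (∀ {t} → t ≤ ℓ → ¬ (S ∣ u (suc t))) →
        ∃ λ g → g < B × Closed S g (u 0) × (∀ {t} → t ≤ ℓ → Open S g (u (suc t)))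
      enter {ℓ} π S∤ with refine-fine (edge π z<s) (S∤ z≤n)
      ... | g , g<B , c , o , _ = g , g<B , c , stay
        where
        stay : ∀ {t} → t ≤ ℓ → Open S g (u (suc t))
        stay {zero}  _   = o
        stay {suc t} t<ℓ with refine-fine (edge π (s<s t<ℓ)) (S∤ t<ℓ)
        ... | h , _ , c′ , o′ , _ with open-closed-unique g h (stay (<⇒≤ t<ℓ)) c′
        ... | refl = o′

      descend : ∀ {ℓ g} → IndPath A (suc ℓ) u → g < B → Closed S g (u 0) →
        (∀ {t} → t ≤ ℓ → Open S g (u (suc t))) → IndPath (Refine B R i) (suc ℓ) (λ t → u t ∸ g * S)
      descend {ℓ} {g} π g<B c o = transport (g * S +_) π recover
        (λ t<ℓ a → fine t<ℓ (subst₂ A (sym (recover (<⇒≤ t<ℓ))) (sym (recover t<ℓ)) a))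
        (λ r → inj₂ (g , g<B , _ , _ , r , refl , refl))
        where
        lower : ∀ {t} → t ≤ suc ℓ → g * S ≤ u t
        lower {zero}  _         = proj₁ c
        lower {suc t} (s≤s t≤ℓ) = <⇒≤ (proj₁ (o t≤ℓ))
        fine : ∀ {t} → t < suc ℓ → A (u t) (u (suc t)) → Refine B R i (u t ∸ g * S) (u (suc t) ∸ g * S)
        fine {t} (s≤s t≤ℓ) a with refine-fine a (open⇒∤ g (o t≤ℓ))
        ... | h , _ , _ , o′ , r with open-closed-unique g h (o t≤ℓ) (<⇒≤ (proj₁ o′) , <⇒≤ (proj₂ o′))
        ... | refl = r
        recover : ∀ {t} → t ≤ suc ℓ → u t ≡ g * S + (u t ∸ g * S)
        recover t≤ℓ = sym (m+[n∸m]≡n (lower t≤ℓ))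

      -- A run of non-multiples between two multiples of S would leave and
      -- re-enter through the two ends of one interval, which are adjacent.
      no-return : ∀ {ℓ} → IndPath A ℓ u → S ∣ u 0 → (1 ≤ ℓ → ¬ (S ∣ u 1)) →
        ∀ {t} → suc t ≤ ℓ → ¬ (S ∣ u (suc t))
      no-return π S∣u₀ S∤u₁ {t} t<ℓ = upTo t ≤-refl t<ℓ
        where
        -- Strong induction on `t`, bounded by `n`: `enter` wants every vertex strictly between the
        -- two multiples to be a non-multiple.
        upTo : ∀ n {t} → t ≤ n → suc t ≤ _ → ¬ (S ∣ u (suc t))
        upTo n       {zero}  _         t<ℓ = S∤u₁ t<ℓ
        upTo (suc n) {suc t} (s≤s t≤n) t<ℓ S∣u with
          enter (prefix (<⇒≤ t<ℓ) π) (λ s≤t → upTo n (≤-trans s≤t t≤n) (≤-trans (s≤s s≤t) (<⇒≤ t<ℓ)))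
        ... | g , g<B , c , o with refine-fine (A.symmetric (edge π t<ℓ)) (open⇒∤ g (o ≤-refl))
        ... | h , _ , c′ , o′ , _ with open-closed-unique g h (o ≤-refl) (<⇒≤ (proj₁ o′) , <⇒≤ (proj₂ o′))
        ... | refl = ends S∣u₀ S∣u
          where
          ends : S ∣ u 0 → S ∣ u (suc (suc t)) → ⊥
          ends (divides x e) (divides y e′)
            with closed-multiple g x (subst (Closed S g) e c) | closed-multiple g y (subst (Closed S g) e′ c′)
          ... | inj₁ refl | inj₁ refl = distinct π z<s t<ℓ (trans e (sym e′))
          ... | inj₂ refl | inj₂ refl = distinct π z<s t<ℓ (trans e (sym e′))
          ... | inj₁ refl | inj₂ refl = chordless π (s<s z<s) t<ℓ
            (inj₁ (g , suc g , F.consecutive g<B , e , e′))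
          ... | inj₂ refl | inj₁ refl = chordless π (s<s z<s) t<ℓ
            (inj₁ (suc g , g , R.symmetric (F.consecutive g<B) , e , e′))

    -- By `no-return`, a path that leaves the multiples of `S` never meets one again, so they form
    -- an initial segment, here of `m` edges.
    multiples-first : ∀ {ℓ u} → IndPath A ℓ u → S ∣ u 0 → ∃₂ λ m n → m + n ≡ ℓ ×
      (∀ {t} → t ≤ m → S ∣ u t) × (∀ {t} → t < n → ¬ (S ∣ u (m + suc t)))
    multiples-first {zero}  π S∣u₀ = 0 , 0 , refl , (λ where z≤n → S∣u₀) , λ ()
    multiples-first {suc ℓ} {u} π S∣u₀ with S ∣? u 1
    ... | no  S∤u₁ = 0 , suc ℓ , refl , (λ where z≤n → S∣u₀) ,
      λ t<n → no-return π S∣u₀ (λ _ → S∤u₁) t<n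
    ... | yes S∣u₁ with multiples-first (suffix 1 π) S∣u₁
    ... | m , n , e , all , none =
      suc m , n , cong suc e , (λ where z≤n → S∣u₀ ; (s≤s t≤m) → all t≤m) , none

  -- Passing to the interval that contains both `x` and `suc x` ends at scale 1, where `R` supplies
  -- the edge. At least one level is required, as `Refine B R 0` has no edges.
  refine-consecutive : ∀ i {x} → x < B ^ suc i → Refine B R (suc i) x (suc x)
  refine-consecutive zero {x} x<B = inj₁
    (x , suc x , F.consecutive (subst (x <_) (*-identityʳ B) x<B) , sym (*-identityʳ x) , sym (*-identityʳ (suc x)))
  refine-consecutive (suc i) {x} x<B = inj₂
    ( x / S , m<n*o⇒m/o<n x<B , x % S , suc (x % S) , refine-consecutive i (m%n<n x S)
    , x≡ , trans (cong suc x≡) (sym (+-suc (x / S * S) (x % S))))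
    where
    S = B ^ suc i
    instance
      S≢0 : NonZero S
      S≢0 = m^n≢0 B (suc i)
    x≡ : x ≡ x / S * S + x % S
    x≡ = trans (m≡m%n+[m/n]*n x S) (+-comm (x % S) (x / S * S))

  -- The extreme vertex `u 0` sees every interior multiple of `B ^ i`, so meeting one two or more
  -- steps away would give a chord.
  beyond-neighbour : ∀ i {ℓ u} → IndPath (Refine B R (suc i)) (suc ℓ) u → u 0 ≡ 0 ⊎ u 0 ≡ B ^ suc i →
    (∀ {t} → t < suc ℓ → 0 < u (suc t) × u (suc t) < B ^ suc i) → ∀ {t} → t < ℓ → ¬ (B ^ i ∣ u (suc (suc t)))
  beyond-neighbour i {u = u} π end inside {t} t<ℓ (divides x e) = chordless π (s<s z<s) (s≤s t<ℓ) (spoke end)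
    where
    0<x : 0 < x
    0<x = *-cancelʳ-< (B ^ i) 0 x (subst (0 <_) e (proj₁ (inside (s<s t<ℓ))))
    x<B : x < B
    x<B = *-cancelʳ-< (B ^ i) x B (subst (_< B ^ suc i) e (proj₂ (inside (s<s t<ℓ))))
    spoke : u 0 ≡ 0 ⊎ u 0 ≡ B ^ suc i → Refine B R (suc i) (u 0) (u (suc (suc t)))
    spoke (inj₁ e₀) = inj₁ (0 , x , F.left 0<x (<⇒≤ x<B) , e₀ , e)
    spoke (inj₂ e₀) = inj₁ (B , x , R.symmetric (F.right x<B) , e₀ , e)

  -- After `u 0`, only `u 1` can be a multiple of the next scale, by `beyond-neighbour`. So after at
  -- most one edge the path avoids these multiples and `fine-tail≤` applies: each scale costs at
  -- most one edge.
  tail≤ : ∀ i {ℓ u} → IndPath (Refine B R i) ℓ u → u 0 ≡ 0 ⊎ u 0 ≡ B ^ i →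
    (∀ {t} → t < ℓ → 0 < u (suc t) × u (suc t) < B ^ i) → ℓ ≤ i
  -- The path stays in one interval, and `u 0`, being a multiple, is an end of it. Shifting that
  -- interval to 0 gives the situation of `tail≤` at level `i`.
  fine-tail≤ : ∀ i {ℓ u} → IndPath (Refine B R (suc i)) ℓ u → B ^ i ∣ u 0 →
    (∀ {t} → t < ℓ → ¬ (B ^ i ∣ u (suc t))) → ℓ ≤ i

  tail≤ i       {zero}      π end inside = z≤n
  tail≤ zero    {suc ℓ}     π end inside = contradiction (edge π z<s) λ ()
  tail≤ (suc i) {suc ℓ} {u} π end inside with B ^ i ∣? u 1
  ... | yes S∣u₁ = s≤s (fine-tail≤ i (suffix 1 π) S∣u₁ (beyond-neighbour i π end inside))
  ... | no  S∤u₁ = m≤n⇒m≤1+n (fine-tail≤ i π (end-multiple end)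
    (λ where z<s → S∤u₁ ; (s<s t<ℓ@(s≤s _)) → beyond-neighbour i π end inside t<ℓ))
    where
    end-multiple : u 0 ≡ 0 ⊎ u 0 ≡ B ^ suc i → B ^ i ∣ u 0
    end-multiple (inj₁ e) = divides 0 e
    end-multiple (inj₂ e) = divides B e

  fine-tail≤ i {zero}      π S∣u₀ S∤ = z≤n
  fine-tail≤ i {suc ℓ} {u} π (divides x e) S∤ with enter i π (λ t≤ℓ → S∤ (s≤s t≤ℓ))
  ... | g , g<B , c , o = tail≤ i (descend i π g<B c o) end inside
    where
    S = B ^ i
    instance
      S≢0 : NonZero S
      S≢0 = m^n≢0 B i
    end : u 0 ∸ g * S ≡ 0 ⊎ u 0 ∸ g * S ≡ S
    end with closed-multiple g x (subst (Closed S g) e c)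
    ... | inj₁ refl = inj₁ (trans (cong (_∸ g * S) e) (n∸n≡0 (g * S)))
    ... | inj₂ refl = inj₂ (trans (cong (_∸ g * S) e) (m+n∸n≡m S (g * S)))
    inside : ∀ {t} → t < suc ℓ → 0 < u (suc t) ∸ g * S × u (suc t) ∸ g * S < S
    inside (s≤s t≤ℓ) with o t≤ℓ
    ... | p , q = m<n⇒0<n∸m p , subst (_∸_ _ (g * S) <_) (m+n∸n≡m S (g * S)) (∸-monoˡ-< q (<⇒≤ p))

  -- A long path is a tail inside one interval, then an induced path of R,
  -- then another tail.
  refine-path≤ : ∀ {Φ} → (∀ {ℓ u} → IndPath R ℓ u → ℓ ≤ Φ) →
    ∀ i {ℓ u} → IndPath (Refine B R i) ℓ u → ℓ ≤ i + (Φ + i)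
  refine-path≤ ≤Φ i       {zero}      π = z≤n
  refine-path≤ ≤Φ zero    {suc ℓ}     π = contradiction (edge π z<s) λ ()
  refine-path≤ {Φ} ≤Φ (suc i) {suc ℓ} {u} π with first (λ t → B ^ i ∣? u t) (suc ℓ)
  -- Without multiples of `B ^ i` the path lies in one interval, and the bound one level down
  -- applies. So `Φ` is paid once, at the coarsest scale with a multiple on the path.
  ... | inj₁ S∤ with enter i π (λ t≤ℓ → S∤ (s≤s t≤ℓ))
  ...   | g , g<B , c , o = ≤-trans (refine-path≤ ≤Φ i (descend i π g<B c o))
    (+-mono-≤ (n≤1+n i) (+-monoʳ-≤ Φ (n≤1+n i)))
  refine-path≤ {Φ} ≤Φ (suc i) {suc ℓ} {u} π | inj₂ (c , n , e , S∣ , S∤)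
    with subst (λ k → IndPath (Refine B R (suc i)) k u) (sym e) π
  ... | π′ with multiples-first i (suffix c π′) (subst (λ k → B ^ i ∣ u k) (sym (+-identityʳ c)) S∣)
  ... | m , n′ , refl , all , none = begin
    suc ℓ                  ≡⟨ e ⟨
    c + (m + n′)           ≤⟨ +-mono-≤ c≤i (+-mono-≤ m≤Φ n′≤i) ⟩
    i + (Φ + i)            ≤⟨ +-mono-≤ (n≤1+n i) (+-monoʳ-≤ Φ (n≤1+n i)) ⟩
    suc i + (Φ + suc i)    ∎
    where
    open ≤-Reasoning
    S = B ^ i
    instance
      S≢0 : NonZero S
      S≢0 = m^n≢0 B i
    c≤i : c ≤ i
    -- Reversed, the initial piece starts at the first multiple and then avoids multiples.
    c≤i = fine-tail≤ i
      (reversal (IsGraphOn.symmetric (refine-isGraphOn graph (suc i))) (prefix (m≤m+n c (m + n′)) π′))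
      S∣ (λ t<c → S∤ (∸-monoʳ-< z<s t<c))
    n′≤i : n′ ≤ i
    n′≤i = fine-tail≤ i (suffix m (suffix c π′)) (all (≤-reflexive (+-identityʳ m))) none
    m≤Φ : m ≤ Φ
    -- Divided by `S`, the middle piece is an induced path of `R`, by `refine-coarse`.
    m≤Φ = ≤Φ (transport {v = λ t → u (c + t) / S} (_* S) (prefix (m≤m+n m n′) (suffix c π′))
      (λ t≤m → sym (m/n*n≡m (all t≤m))) (λ _ → refine-coarse i) (λ r → inj₁ (_ , _ , r , refl , refl)))

-- Books and their refinement.

Union : ∀ {m} → (Fin m → Rel ℕ 0ℓ) → Rel ℕ 0ℓ
Union E x y = ∃ λ c → E c x y

-- A book embedding with spine 0, ..., B. The path bound concerns the union of the pages, and `Φ`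
-- counts edges.
record IsBook (B Φ : ℕ) {m : ℕ} (E : Fin m → Rel ℕ 0ℓ) : Set where
  field
    isGraphOn   : ∀ c → IsGraphOn B (E c)
    planar      : ∀ c → Planar (E c)
    consecutive : ∀ {x} → x < B → Union E x (suc x)
    path≤       : ∀ {ℓ u} → IndPath (Union E) ℓ u → ℓ ≤ Φ

union-isGraphOn : ∀ {B m} {E : Fin m → Rel ℕ 0ℓ} → (∀ c → IsGraphOn B (E c)) → IsGraphOn B (Union E)
union-isGraphOn graph = record
  { symmetric   = λ (c , e) → c , IsGraphOn.symmetric (graph c) e
  ; irreflexive = λ x≡y (c , e) → IsGraphOn.irreflexive (graph c) x≡y e
  ; bounded     = λ (c , e) → IsGraphOn.bounded (graph c) e
  ; decidable   = λ x y → any? λ c → IsGraphOn.decidable (graph c) x y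
  }

module _ {B m : ℕ} {E : Fin m → Rel ℕ 0ℓ} where

  -- Every edge of a refinement is a copy of one edge of `R`, hence inherits a page; refining page
  -- by page therefore costs no page.
  refine-union⁺ : ∀ i {x y} → Union (λ c → Refine B (E c) i) x y → Refine B (Union E) i x y
  refine-union⁺ (suc i) (c , inj₁ (x , y , r , e))           = inj₁ (x , y , (c , r) , e)
  refine-union⁺ (suc i) (c , inj₂ (g , g<B , x , y , r , e)) = inj₂ (g , g<B , x , y , refine-union⁺ i (c , r) , e)

  refine-union⁻ : ∀ i {x y} → Refine B (Union E) i x y → Union (λ c → Refine B (E c) i) x y
  refine-union⁻ (suc i) (inj₁ (x , y , (c , r) , e))     = c , inj₁ (x , y , r , e)
  refine-union⁻ (suc i) (inj₂ (g , g<B , x , y , r , e)) with refine-union⁻ i r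
  ... | c , r′ = c , inj₂ (g , g<B , x , y , r′ , e)

  refine-isBook : ∀ {Φ} .{{_ : NonZero B}} → IsBook B Φ E → IsFramed B (Union E) → ∀ i →
    IsBook (B ^ suc i) (suc i + (Φ + suc i)) (λ c → Refine B (E c) (suc i))
  refine-isBook book framed i = record
    { isGraphOn   = λ c → refine-isGraphOn (isGraphOn c) (suc i)
    ; planar      = λ c → refine-planar (isGraphOn c) (planar c) (suc i)
    ; consecutive = refine-union⁻ (suc i) ∘ refine-consecutive graph framed i
    ; path≤       = λ π → refine-path≤ graph framed path≤ (suc i)
        (transport id π (λ _ → refl) (λ _ → refine-union⁺ (suc i)) (refine-union⁻ (suc i)))
    }
    where
    open IsBook book
    graph = union-isGraphOn isGraphOn

-- Framing a book by two stars.

Star : ℕ → ℕ → Rel ℕ 0ℓ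
Star B z x y = x ≤ B × y ≤ B × x ≢ y × (x ≡ z ⊎ y ≡ z)

star-isGraphOn : ∀ B z → IsGraphOn B (Star B z)
star-isGraphOn B z = record
  { symmetric   = λ (p , q , x≢y , e) → q , p , x≢y ∘ sym , swap e
  ; irreflexive = λ x≡y (_ , _ , x≢y , _) → x≢y x≡y
  ; bounded     = proj₁
  ; decidable   = λ x y → x ≤? B ×-dec y ≤? B ×-dec ¬? (x ≟ y) ×-dec (x ≟ z ⊎-dec y ≟ z)
  }

star-planarˡ : ∀ B → Planar (Star B 0)
star-planarˡ B _ (_ , _ , _ , inj₁ refl) () _ _
star-planarˡ B _ (_ , _ , _ , inj₂ refl) _ _ ()

star-planarʳ : ∀ B → Planar (Star B B)
star-planarʳ B (_ , _ , _ , inj₁ refl) (_ , d≤B , _) p q r = <⇒≱ (<-trans p (<-trans q r)) d≤B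
star-planarʳ B (_ , _ , _ , inj₂ refl) (_ , d≤B , _) p q r = <⇒≱ r d≤B

Frame : ∀ {m} → ℕ → (Fin m → Rel ℕ 0ℓ) → Fin (2 + m) → Rel ℕ 0ℓ
Frame B E zero          = Star B 0
Frame B E (suc zero)    = Star B B
Frame B E (suc (suc c)) = E c

-- With at least three edges, each index has another at distance two or more: 2 for 0, 3 for 1, and
-- 0 for all others. An apex would make that pair a chord.
no-apex : ∀ {A ℓ u} → Symmetric A → IndPath A ℓ u → 3 ≤ ℓ → ∀ {t} → t ≤ ℓ →
  ¬ (∀ {s} → s ≤ ℓ → u s ≢ u t → A (u t) (u s))
no-apex A-sym π 3≤ℓ {zero} t≤ℓ adj =
  chordless π (s<s z<s) 2≤ℓ (adj 2≤ℓ (distinct π z<s 2≤ℓ ∘ sym))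
  where
  open IndPath
  2≤ℓ = <⇒≤ 3≤ℓ
no-apex A-sym π 3≤ℓ {suc zero} t≤ℓ adj =
  chordless π (s<s (s<s z<s)) 3≤ℓ (adj 3≤ℓ (distinct π (s<s z<s) 3≤ℓ ∘ sym))
  where open IndPath
no-apex A-sym π 3≤ℓ {suc (suc t)} t≤ℓ adj =
  chordless π (s<s z<s) t≤ℓ (A-sym (adj z≤n (distinct π z<s t≤ℓ)))
  where open IndPath

path-bounded : ∀ {A B ℓ u} → IsGraphOn B A → IndPath A (suc ℓ) u → ∀ {t} → t ≤ suc ℓ → u t ≤ B
path-bounded graph π {zero}  _   = IsGraphOn.bounded graph (IndPath.edge π z<s)
path-bounded graph π {suc t} t<ℓ = IsGraphOn.boundedʳ graph (IndPath.edge π t<ℓ)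

module _ {B Φ m : ℕ} {E : Fin m → Rel ℕ 0ℓ} (book : IsBook B Φ E) where
  open IsBook book

  frame-isFramed : IsFramed B (Union (Frame B E))
  frame-isFramed = record
    { consecutive = λ x<B → case consecutive x<B of λ (c , e) → suc (suc c) , e
    ; left        = λ 0<y y≤B → zero , z≤n , y≤B , <⇒≢ 0<y , inj₁ refl
    ; right       = λ x<B → suc zero , <⇒≤ x<B , ≤-refl , <⇒≢ x<B , inj₂ refl
    }

  frame-isGraphOn : ∀ c → IsGraphOn B (Frame B E c)
  frame-isGraphOn zero          = star-isGraphOn B 0
  frame-isGraphOn (suc zero)    = star-isGraphOn B B
  frame-isGraphOn (suc (suc c)) = isGraphOn c

  private
    graph = union-isGraphOn frame-isGraphOn

  -- By `no-apex`, a path with three or more edges avoids 0 and `B`, hence uses no star edge and is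
  -- induced in the old book. Shorter paths are covered by `2 ≤ Φ`.
  frame-path≤ : 2 ≤ Φ → ∀ {ℓ u} → IndPath (Union (Frame B E)) ℓ u → ℓ ≤ Φ
  frame-path≤ 2≤Φ {zero} π = z≤n
  frame-path≤ 2≤Φ {suc ℓ} {u} π with 3 ≤? suc ℓ
  ... | no  3≰ℓ = ≤-trans (m<1+n⇒m≤n (≰⇒> 3≰ℓ)) 2≤Φ
  ... | yes 3≤ℓ = path≤ (record
    { distinct  = distinct
    ; edge      = λ t<ℓ → inner t<ℓ (edge t<ℓ)
    ; chordless = λ i<j j≤ℓ (c , e) → chordless i<j j≤ℓ (suc (suc c) , e)
    })
    where
    open IndPath π
    ¬hub : ∀ {z t} → t ≤ suc ℓ → u t ≡ z → z ≤ B →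
      ¬ (∀ y → y ≤ B → y ≢ z → Union (Frame B E) z y)
    ¬hub t≤ℓ refl z≤B adj = no-apex (IsGraphOn.symmetric graph) π 3≤ℓ t≤ℓ (λ s≤ℓ → adj _ (path-bounded graph π s≤ℓ))

    hub₀ : ∀ y → y ≤ B → y ≢ 0 → Union (Frame B E) 0 y
    hub₀ _ y≤B y≢0 = zero , z≤n , y≤B , y≢0 ∘ sym , inj₁ refl

    hub₁ : ∀ y → y ≤ B → y ≢ B → Union (Frame B E) B y
    hub₁ _ y≤B y≢B = suc zero , ≤-refl , y≤B , y≢B ∘ sym , inj₁ refl

    inner : ∀ {t} → t < suc ℓ → Union (Frame B E) (u t) (u (suc t)) → Union E (u t) (u (suc t))
    inner t<ℓ (zero , _ , _ , _ , inj₁ e)     = contradiction hub₀ (¬hub (<⇒≤ t<ℓ) e z≤n)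
    inner t<ℓ (zero , _ , _ , _ , inj₂ e)     = contradiction hub₀ (¬hub t<ℓ e z≤n)
    inner t<ℓ (suc zero , _ , _ , _ , inj₁ e) = contradiction hub₁ (¬hub (<⇒≤ t<ℓ) e ≤-refl)
    inner t<ℓ (suc zero , _ , _ , _ , inj₂ e) = contradiction hub₁ (¬hub t<ℓ e ≤-refl)
    inner t<ℓ (suc (suc c) , e)               = c , e

  frame-isBook : 2 ≤ Φ → IsBook B Φ (Frame B E)
  frame-isBook 2≤Φ = record
    { isGraphOn   = frame-isGraphOn
    ; planar      = λ where
        zero          → star-planarˡ B
        (suc zero)    → star-planarʳ B
        (suc (suc c)) → planar c
    ; consecutive = IsFramed.consecutive frame-isFramed
    ; path≤       = frame-path≤ 2≤Φ
    }

-- The triangle and the iteration.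

Triangle : Fin 1 → Rel ℕ 0ℓ
Triangle _ x y = x ≤ 2 × y ≤ 2 × x ≢ y

triangle-isFramed : IsFramed 2 (Union Triangle)
triangle-isFramed = record
  { consecutive = λ x<2 → zero , <⇒≤ x<2 , x<2 , <⇒≢ ≤-refl
  ; left        = λ 0<y y≤2 → zero , z≤n , y≤2 , <⇒≢ 0<y
  ; right       = λ x<2 → zero , <⇒≤ x<2 , ≤-refl , <⇒≢ x<2
  }

-- A crossing needs four distinct vertices, and a path with two edges has a chord. The path bound is
-- recorded as 2 so that `2≤Φ` holds from the base case on.
triangle-isBook : IsBook 2 2 Triangle
triangle-isBook = record
  { isGraphOn   = graph
  ; planar      = λ where
      _ _ (_ , d≤2 , _) p q r → <⇒≱ (≤-trans (s<s (≤-trans (s<s (≤-trans (s≤s z≤n) p)) q)) r) d≤2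
  ; consecutive = IsFramed.consecutive triangle-isFramed
  ; path≤       = bound
  }
  where
  graph : ∀ c → IsGraphOn 2 (Triangle c)
  graph _ = record
    { symmetric   = λ (p , q , x≢y) → q , p , x≢y ∘ sym
    ; irreflexive = λ x≡y (_ , _ , x≢y) → x≢y x≡y
    ; bounded     = proj₁
    ; decidable   = λ x y → x ≤? 2 ×-dec y ≤? 2 ×-dec ¬? (x ≟ y)
    }
  bound : ∀ {ℓ u} → IndPath (Union Triangle) ℓ u → ℓ ≤ 2
  bound {zero}              π = z≤n
  bound {suc zero}          π = s≤s z≤n
  bound {suc (suc ℓ)} {u} π = contradiction
    (zero , path-bounded (union-isGraphOn graph) π z≤n , path-bounded (union-isGraphOn graph) π (s≤s (s≤s z≤n)) ,
      IndPath.distinct π z<s (s≤s (s≤s z≤n)))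
    (IndPath.chordless π (s<s z<s) (s≤s (s≤s z≤n)))

-- Recursive so that the page count of `Frame` matches by computation; `pages≡` gives the closed
-- form.
pages : ℕ → ℕ
pages zero    = 1
pages (suc k) = 2 + pages k

module Construction (l : ℕ) where
  private
    -- Positive, so that `refine-consecutive` applies.
    L = suc l

  spine : ℕ → ℕ
  spine zero    = 2
  spine (suc k) = spine k ^ L

  edges : ∀ k → Fin (pages k) → Rel ℕ 0ℓ
  edges zero    = Triangle
  edges (suc k) = Frame (spine (suc k)) (λ c → Refine (spine k) (edges k c) L)

  Φ : ℕ → ℕ
  Φ zero    = 2
  Φ (suc k) = L + (Φ k + L)

  2≤Φ : ∀ k → 2 ≤ Φ k
  2≤Φ zero    = ≤-refl
  2≤Φ (suc k) = ≤-trans (2≤Φ k) (≤-trans (m≤m+n (Φ k) L) (m≤n+m (Φ k + L) L))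

  spine≡ : ∀ k → spine k ≡ 2 ^ (L ^ k)
  spine≡ zero    = refl
  spine≡ (suc k) = trans (cong (_^ L) (spine≡ k)) (trans (^-*-assoc 2 (L ^ k) L) (cong (2 ^_) (*-comm (L ^ k) L)))

  spine≢0 : ∀ k → NonZero (spine k)
  spine≢0 zero    = _
  spine≢0 (suc k) = m^n≢0 (spine k) L {{spine≢0 k}}

  -- `edges k` has undergone k refinements and k framings. `refined-isBook k` adds one more
  -- refinement and no frame: k + 1 rounds on 2k + 1 pages.
  edges-isBook : ∀ k → IsBook (spine k) (Φ k) (edges k) × IsFramed (spine k) (Union (edges k))
  refined-isBook : ∀ k → IsBook (spine (suc k)) (Φ (suc k)) (λ c → Refine (spine k) (edges k c) L)

  edges-isBook zero    = triangle-isBook , triangle-isFramed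
  edges-isBook (suc k) = frame-isBook (refined-isBook k) (2≤Φ (suc k)) , frame-isFramed (refined-isBook k)

  refined-isBook k = case edges-isBook k of λ (book , framed) →
    refine-isBook {{spine≢0 k}} book framed l

-- From books to ordered graphs.

least : ∀ {m} {P : Fin m → Set} → (∀ c → Dec (P c)) → ∃ P → ∃ λ c → P c × (∀ d → d Fin.< c → ¬ P d)
least {suc m} P? (c , p) with P? zero | c
... | yes p₀ | _      = zero , p₀ , λ _ ()
... | no ¬p₀ | zero   = contradiction p ¬p₀
... | no ¬p₀ | suc c′ with least (P? ∘ suc) (c′ , p)
... | d , q , ¬q = suc d , q , λ where
  zero    _         → ¬p₀
  (suc e) (s≤s e<d) → ¬q e e<d

module _ {M Φ m : ℕ} {E : Fin m → Rel ℕ 0ℓ} (book : IsBook M Φ E) where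
  open IsBook book
  private
    module U = IsGraphOn (union-isGraphOn isGraphOn)
    module E c = IsGraphOn (isGraphOn c)

  orderedGraph : OrderedGraph (suc M)
  orderedGraph = record
    { V                  = Fin (suc M)
    ; vertices           = ↔-id _
    ; Adj                = λ a b → Union E (toℕ a) (toℕ b)
    ; adj?               = λ a b → U.decidable (toℕ a) (toℕ b)
    ; adj-sym            = U.symmetric
    ; adj-irrefl         = λ a≡b → U.irreflexive (cong toℕ a≡b)
    ; _≺_                = Fin._<_
    ; isStrictTotalOrder = <-isStrictTotalOrder
    }

  alongHamiltonianPath : OrderedAlongHamiltonianPath orderedGraph
  alongHamiltonianPath = id , record { increasing = id ; surjective = λ a → a , id } ,
    λ i j e → subst (Union E (toℕ i)) (sym e) (consecutive (subst (_≤ M) e (m<1+n⇒m≤n (toℕ<n j))))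

  -- The pages may overlap; an edge is assigned to the first one containing it.
  firstPage : Fin m → Rel (Fin (suc M)) 0ℓ
  firstPage c a b = E c (toℕ a) (toℕ b) × (∀ d → d Fin.< c → ¬ E d (toℕ a) (toℕ b))

  book-nonCrossing : _-NonCrossing orderedGraph m
  book-nonCrossing = firstPage , record
    { isEdgeSet   = λ c → record
      { symmetric = λ (e , ¬e) → E.symmetric c e , λ d d<c → ¬e d d<c ∘ E.symmetric d
      ; edges     = λ (e , _) → c , e
      }
    ; partition   = λ {a} {b} adj → case least (λ c → E.decidable c (toℕ a) (toℕ b)) adj of
      λ (c , e) → c , e , λ {d} → unique {c} {d} {a} {b} e
    ; nonCrossing = λ c (e , _) (e′ , _) (p , q , r) → planar c e e′ p q r
    }
    where
    unique : ∀ {c d a b} → firstPage c a b → firstPage d a b → c ≡ d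
    unique {c} {d} (e , ¬e) (e′ , ¬e′) with Fin.<-cmp c d
    ... | tri< c<d _ _ = contradiction e (¬e′ _ c<d)
    ... | tri≈ _ c≡d _ = c≡d
    ... | tri> _ _ d<c = contradiction e′ (¬e _ d<c)

  inducedPath≤ : ∀ {p} {u : Fin p → Fin (suc M)} → IsInducedPath orderedGraph u → p ≤ suc Φ
  inducedPath≤ {zero}      π = z≤n
  -- Reduction `mod suc ℓ` extends `u` to all of ℕ and fixes every index up to `ℓ`. The outer `s≤s`
  -- turns edges into vertices.
  inducedPath≤ {suc ℓ} {u} π = s≤s (path≤ (record
    { distinct  = λ i<j j≤ℓ e → <⇒≢ i<j
        (toℕ-mod⁻¹ (≤-trans (<⇒≤ i<j) j≤ℓ) j≤ℓ (injective (toℕ-injective e)))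
    ; edge      = λ {i} i<ℓ → Equivalence.from (induced (i mod suc ℓ) (suc i mod suc ℓ))
        (trans (cong₂ ∣_-_∣ (toℕ-mod (<⇒≤ i<ℓ)) (toℕ-mod i<ℓ))
          (trans (cong (∣ i -_∣) (+-comm 1 i)) (∣m-m+n∣≡n i 1)))
    ; chordless = λ {i} {j} i<j j≤ℓ e → far i<j (trans
        (sym (cong₂ ∣_-_∣ (toℕ-mod (≤-trans (<⇒≤ (<⇒≤ i<j)) j≤ℓ)) (toℕ-mod j≤ℓ)))
        (Equivalence.to (induced (i mod suc ℓ) (j mod suc ℓ)) e))
    }))
    where
    open IsInducedPath π
    far : ∀ {i j} → suc i < j → ∣ i - j ∣ ≢ 1
    far {zero}  (s<s (s<s _)) ()
    far {suc i} (s<s i<j)     = far i<j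
    toℕ-mod : ∀ {t} → t ≤ ℓ → toℕ (t mod suc ℓ) ≡ t
    toℕ-mod {t} t≤ℓ = trans (toℕ-fromℕ< (m%n<n t (suc ℓ))) (m<n⇒m%n≡m (s≤s t≤ℓ))
    toℕ-mod⁻¹ : ∀ {s t} → s ≤ ℓ → t ≤ ℓ → s mod suc ℓ ≡ t mod suc ℓ → s ≡ t
    toℕ-mod⁻¹ s≤ℓ t≤ℓ e = trans (sym (toℕ-mod s≤ℓ)) (trans (cong toℕ e) (toℕ-mod t≤ℓ))

-- Numerical bounds and the theorem.

^-distribʳ-* : ∀ a b r → (a * b) ^ r ≡ a ^ r * b ^ r
^-distribʳ-* a b zero    = refl
^-distribʳ-* a b (suc r) = trans (cong (a * b *_) (^-distribʳ-* a b r)) ([m*n]*[o*p]≡[m*o]*[n*p] a b (a ^ r) (b ^ r))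

n<2^n : ∀ n → n < 2 ^ n
n<2^n zero    = z<s
n<2^n (suc n) = ≤-trans (s≤s (n<2^n n)) (+-mono-≤ (m^n>0 2 n) (m≤m+n (2 ^ n) 0))

pages≡ : ∀ k → pages k ≡ 2 * k + 1
pages≡ zero    = refl
pages≡ (suc k) = trans (cong (2 +_) (pages≡ k)) (cong (_+ 1) (sym (*-suc 2 k)))

constant : ℕ → ℕ
constant zero    = 3
constant (suc k) = 2 + constant k

-- Each round adds `2 * L`, which raises the constant by 2; at the base, 3 is at most `3 * L` as `L`
-- is positive. The successor counts vertices instead of edges.
Φ≤ : ∀ l k → suc (Construction.Φ l k) ≤ constant k * suc l
Φ≤ l zero    = *-monoʳ-≤ 3 (s≤s z≤n)
Φ≤ l (suc k) = begin
  suc (L + (Φ k + L))        ≡⟨ cong (λ t → suc (L + t)) (+-comm (Φ k) L) ⟩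
  suc (L + (L + Φ k))        ≡⟨ cong suc (+-assoc L L (Φ k)) ⟨
  suc (L + L + Φ k)          ≡⟨ +-suc (L + L) (Φ k) ⟨
  L + L + suc (Φ k)          ≤⟨ +-monoʳ-≤ (L + L) (Φ≤ l k) ⟩
  L + L + constant k * L     ≡⟨ +-assoc L L (constant k * L) ⟩
  L + (L + constant k * L)   ∎
  where
  open ≤-Reasoning
  open Construction l
  L = suc l

-- Here `L` is exactly the `r`-th root of the binary logarithm of `M`; the only loss is from `M` to
-- `suc M`, the number of vertices.
≤-root-log : ∀ {p C L M} r → p ≤ C * L → M ≡ 2 ^ (L ^ r) → p ≤ C ·[log₂ suc M ]^1/ r
≤-root-log {p} {C} {L} r p≤CL refl = begin
  2 ^ (p ^ r)             ≤⟨ ^-monoʳ-≤ 2 (^-monoˡ-≤ r p≤CL) ⟩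
  2 ^ ((C * L) ^ r)       ≡⟨ cong (2 ^_) (trans (^-distribʳ-* C L r) (*-comm (C ^ r) (L ^ r))) ⟩
  2 ^ (L ^ r * C ^ r)     ≡⟨ ^-*-assoc 2 (L ^ r) (C ^ r) ⟨
  (2 ^ (L ^ r)) ^ (C ^ r) ≤⟨ ^-monoˡ-≤ (C ^ r) (n≤1+n _) ⟩
  suc (2 ^ (L ^ r)) ^ (C ^ r) ∎
  where open ≤-Reasoning

corollary5p8 : (k : ℕ) → ∃[ C ] ((N : ℕ) → ∃[ n ] (N ≤ n ×
    (Σ[ G ∈ OrderedGraph n ]
    (OrderedAlongHamiltonianPath G
    × _-NonCrossing G (2 * k + 1)
    × (∀ (p : ℕ) (u : Fin p → OrderedGraph.V G) → IsInducedPath G u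
    → p ≤ C ·[log₂ n ]^1/ (k + 1))))))
corollary5p8 k = constant (suc k) , λ N →
  let open Construction N
      book = refined-isBook k
  in suc (spine (suc k))
   -- With `L = suc N`, the spine 2^(L^(k+1)) is at least 2^L, which exceeds `N`.
   , ≤-trans (n≤1+n N) (≤-trans (<⇒≤ (n<2^n (suc N)))
       (≤-trans (^-monoʳ-≤ 2 (m≤m*n (suc N) (suc N ^ k) {{m^n≢0 (suc N) k}}))
       (≤-trans (≤-reflexive (sym (spine≡ (suc k)))) (n≤1+n _))))
   , orderedGraph book
   , alongHamiltonianPath book
   , subst (_-NonCrossing (orderedGraph book)) (pages≡ k) (book-nonCrossing book)
   , λ p u π → subst (λ r → p ≤ constant (suc k) ·[log₂ suc (spine (suc k)) ]^1/ r) (+-comm 1 k)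
       (≤-root-log {L = suc N} (suc k) (≤-trans (inducedPath≤ book π) (Φ≤ N (suc k))) (spine≡ (suc k)))
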